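{- There is a constant $C$ such that every path restricted ordered bipartite graph $G=(U,V,E)$ with $n=|U|+|V|\ge 2$ vertices satisfies $|E|\le n\log_2 n + Cn$. Moreover, this bound is tight up to the constant factor: there is a constant $c>0$ such that for every $n\ge 2$ there exists a path restricted ordered bipartite graph on $n$ vertices with at least $c\,n\log n$ edges.
   Context: An ordered bipartite graph is a triple $G=(U,V,E)$ where $U$ and $V$ are disjoint finite sets, each equipped with a total order (both denoted $<$), and $E\subseteq U\times V$ is a set of edges. A forward path in $G$ is a sequence $w_0,w_1,\dots,w_m$ ($m\ge1$) of distinct vertices alternating between $U$ and $V$, with $\{w_{k-1},w_k\}\in E$ for all $k$, such that the vertices of the sequence lying in $U$ appear in strictly increasing order along the sequence and the vertices lying in $V$ also appear in strictly increasing order along the sequence (a path whose $U$-vertices and $V$-vertices are both strictly decreasing is the same path read in reverse). The range of the forward path is the pair of intervals $\langle u_a,u_b\rangle=\{u\in U: u_a\le u\le u_b\}$ and $\langle v_c,v_d\rangle=\{v\in V: v_c\le v\le v_d\}$, where $u_a,u_b$ (resp. $v_c,v_d$) are the smallest and largest $U$-vertices (resp. $V$-vertices) on the path. A back edge to such a forward path is an edge $\{w_0,x\}\in E$ where $x$ lies in the part ($U$ or $V$) not containing $w_0$ and $w_1 < x \le M$, with $M$ the largest vertex of the path in that part (so $x$ lies in the range of the path). $G$ has the path restricted property, and is called a path restricted ordered bipartite graph (PRBG), if no forward path in $G$ has a back edge in $E$. -}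

module Defs where

open import Data.Empty using (⊥)
open import Data.Fin.Base as Fin using (Fin; zero; suc; inject₁)
open import Data.List.Base using (length; filter; allFin; cartesianProduct)
open import Data.Nat.Base using (ℕ; suc; _+_; _*_; _^_; _≤_)
open import Data.Integer.Base using (∣_∣)
open import Data.Product.Base using (∃-syntax; _×_; uncurry)
open import Data.Rational.Base using (ℚ; ↥_; ↧ₙ_)
open import Data.Sum.Base using (_⊎_; inj₁; inj₂)
open import Data.Sum.Relation.Binary.Pointwise using (Pointwise)
open import Data.Unit.Base using (⊤)
open import Data.Vec.Functional using (Vector)
open import Function.Definitions using (Injective)
open import Level using (0ℓ)
open import Relation.Binary.Core using (REL)
open import Relation.Binary.Definitions using (Decidable)
open import Relation.Binary.PropositionalEquality.Core using (_≡_)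
open import Relation.Nullary.Negation.Core using (¬_)

-- The finite totally ordered sets U and V are taken to be Fin p and Fin q with
-- their standard orders (every finite total order is isomorphic to a unique
-- one of these). Decidability makes the edge set E a finite set.
record OrderedBipartiteGraph (p q : ℕ) : Set₁ where
  field
    Edge  : REL (Fin p) (Fin q) 0ℓ
    edge? : Decidable Edge

  Vertex : Set
  Vertex = Fin p ⊎ Fin q

  numVertices : ℕ
  numVertices = p + q

  numEdges : ℕ
  numEdges = length (filter (λ e → uncurry edge? e) (cartesianProduct (allFin p) (allFin q)))

  Adj : Vertex → Vertex → Set
  Adj (inj₁ u) (inj₂ v) = Edge u v
  Adj (inj₂ v) (inj₁ u) = Edge u v
  Adj (inj₁ _) (inj₁ _) = ⊥
  Adj (inj₂ _) (inj₂ _) = ⊥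

  SamePart : Vertex → Vertex → Set
  SamePart = Pointwise (λ _ _ → ⊤) (λ _ _ → ⊤)

  -- Vertices of different parts are incomparable.
  _<ᵛ_ _≤ᵛ_ : Vertex → Vertex → Set
  _<ᵛ_ = Pointwise Fin._<_ Fin._<_
  _≤ᵛ_ = Pointwise Fin._≤_ Fin._≤_

  -- The sequence w₀, …, w_m with m = suc l ≥ 1. Alternation between the parts
  -- is forced by `adjacent`, as Adj only relates vertices of different parts.
  record IsForwardPath {l : ℕ} (w : Vector Vertex (suc (suc l))) : Set where
    field
      distinct   : Injective _≡_ _≡_ w
      adjacent   : ∀ (k : Fin (suc l)) → Adj (w (inject₁ k)) (w (suc k))
      increasing : ∀ {i j} → i Fin.< j → SamePart (w i) (w j) → w i <ᵛ w j

  -- M is the largest vertex of w in the part of x.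
  record IsLargestInPartOf {k : ℕ} (w : Vector Vertex k) (x M : Vertex) : Set where
    field
      onPath   : ∃[ i ] w i ≡ M
      samePart : SamePart x M
      largest  : ∀ i → SamePart x (w i) → w i ≤ᵛ M

  record IsBackEdge {l : ℕ} (w : Vector Vertex (suc (suc l))) (x : Vertex) : Set where
    field
      edge  : Adj (w zero) x
      w₁<x  : w (suc zero) <ᵛ x
      x≤max : ∃[ M ] IsLargestInPartOf w x M × x ≤ᵛ M

  IsPathRestricted : Set
  IsPathRestricted =
    ∀ {l} (w : Vector Vertex (suc (suc l))) → IsForwardPath w → ∀ x → ¬ IsBackEdge w x

-- e ≤ n log₂ n + C n, with 2^_ applied to both sides.
_≤nlog₂n+Cn[n=_,C=_] : ℕ → ℕ → ℕ → Set
e ≤nlog₂n+Cn[n= n ,C= C ] = 2 ^ e ≤ n ^ n * 2 ^ (C * n)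

-- c n log₂ n ≤ e for a nonnegative rational c = a / b: this is
-- a n log₂ n ≤ b e, with 2^_ applied to both sides.
_≥cnlog₂n[c=_,n=_] : ℕ → ℚ → ℕ → Set
e ≥cnlog₂n[c= c ,n= n ] = n ^ (∣ ↥ c ∣ * n) ≤ 2 ^ (↧ₙ c * e)

{-# OPTIONS --safe #-}
module Submission where

-- Upper bound (Füredi's halving argument).  Call an edge (u , a) short-stepping
-- if u has neighbours b ≤ m beyond a with b − a ≤ (m − a) / 2.  If (u , a)
-- and (u′ , a) with u < u′ are both short-stepping, the forward path u, a, u′, m′
-- forces m′ < b, so m − a more than halves down a column.  Along the edges of a
-- row which are not short-stepping, the distance to the last of them more than
-- halves.  Hence each row and each column receives at most 1 + log₂ n edges of
-- its kind.
--
-- Lower bound.  Join u and v when u + v + 2 ^ t = q for some t.  If u₀v₀, u₁v₀ and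
-- u₀v are edges with u₀ < u₁ and v₀ < v, then the exponents of the last two are
-- smaller than that of the first, whence q ≤ u₁ + v; but beyond u₁ a forward path
-- only meets v-vertices w with u₁ + w < q.

open import Data.Fin.Base as Fin using (Fin; zero; suc; inject₁; toℕ; fromℕ<)
open import Data.Fin.Properties using (toℕ<n; toℕ-injective; toℕ-fromℕ<; injective⇒≤; any?; <-cmp)
  renaming (_<?_ to _<ᶠ?_; _≤?_ to _≤ᶠ?_)
open import Data.Integer.Base using (1ℤ)
open import Data.List.Base using (List; []; _∷_; length; filter; allFin; cartesianProduct; map; _++_)
open import Data.List.Membership.Propositional using (_∈_)
open import Data.List.Membership.Propositional.Properties using (∈-filter⁺; ∈-allFin)
open import Data.List.Membership.Setoid.Properties using (index-injective)
open import Data.List.Properties using (filter-++; length-++; length-tabulate)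
open import Data.List.Relation.Unary.All as All using (All; []; _∷_)
open import Data.List.Relation.Unary.All.Properties using (all-filter)
open import Data.List.Relation.Unary.AllPairs using (AllPairs; []; _∷_)
open import Data.List.Relation.Unary.AllPairs.Properties using (tabulate⁺-<; filter⁺)
open import Data.Nat.Base hiding (_/_; _%_)
open import Data.Nat.DivMod using (_/_; _%_; m/n*n≤m; m%n<n; m≡m%n+[m/n]*n)
open import Data.Nat.ListAction using (sum)
open import Data.Nat.Properties as Nat hiding (<-cmp)
open import Algebra.Properties.CommutativeSemigroup +-commutativeSemigroup using (x∙yz≈y∙xz) renaming (interchange to +-interchange)
open import Algebra.Properties.CommutativeSemigroup *-commutativeSemigroup using () renaming (interchange to *-interchange)
open import Data.Nat.Tactic.RingSolver using (solve-∀)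
open import Data.Product.Base using (Σ-syntax; ∃-syntax; _×_; _,_; uncurry)
open import Data.Rational.Base using (ℚ; Positive) renaming (_/_ to _/ℚ_)
open import Data.Sum.Base using (_⊎_; inj₁; inj₂; [_,_])
open import Data.Sum.Relation.Binary.Pointwise using (inj₁; inj₂)
open import Data.Unit.Base using (tt)
open import Data.Vec.Functional using (Vector)
open import Function.Base using (id)
open import Function.Definitions using (Injective)
open import Level using (Level)
open import Relation.Binary.Definitions using (tri<; tri≈; tri>) renaming (Decidable to Decidable₂)
open import Relation.Binary.PropositionalEquality using (_≡_; refl; sym; trans; cong; cong₂; subst; setoid; module ≡-Reasoning)
open import Relation.Nullary using (¬_; Dec; yes; no; contradiction)
open import Relation.Nullary.Decidable using (_×-dec_; ¬?)
open import Relation.Unary using (Pred; Decidable)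
open import Defs
open OrderedBipartiteGraph

private
  variable
    ℓ : Level
    A B : Set

-- Counting

count : {P : Pred A ℓ} → Decidable P → List A → ℕ
count P? xs = length (filter P? xs)

sumOver : (A → ℕ) → List A → ℕ
sumOver f xs = sum (map f xs)

module _ {R : A → B → Set} (R? : Decidable₂ R) where

  count-pairs : ∀ x ys → count (uncurry R?) (map (x ,_) ys) ≡ count (R? x) ys
  count-pairs x []       = refl
  count-pairs x (y ∷ ys) with R? x y
  ... | yes _ = cong suc (count-pairs x ys)
  ... | no  _ = count-pairs x ys

  count-cartesianProduct : ∀ xs ys →
    count (uncurry R?) (cartesianProduct xs ys) ≡ sumOver (λ x → count (R? x) ys) xs
  count-cartesianProduct []       ys = refl
  count-cartesianProduct (x ∷ xs) ys = begin
    length (filter R?′ (map (x ,_) ys ++ cartesianProduct xs ys))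
      ≡⟨ cong length (filter-++ R?′ (map (x ,_) ys) _) ⟩
    length (filter R?′ (map (x ,_) ys) ++ filter R?′ (cartesianProduct xs ys))
      ≡⟨ length-++ (filter R?′ (map (x ,_) ys)) ⟩
    count R?′ (map (x ,_) ys) + count R?′ (cartesianProduct xs ys)
      ≡⟨ cong₂ _+_ (count-pairs x ys) (count-cartesianProduct xs ys) ⟩
    count (R? x) ys + sumOver (λ x → count (R? x) ys) xs ∎
    where
    open ≡-Reasoning
    R?′ : Decidable (uncurry R)
    R?′ = uncurry R?

  sumOver-count-∷ : ∀ x xs ys →
    count (R? x) ys + sumOver (λ y → count (λ x → R? x y) xs) ys ≡
    sumOver (λ y → count (λ x → R? x y) (x ∷ xs)) ys
  sumOver-count-∷ x xs []       = refl
  sumOver-count-∷ x xs (y ∷ ys) with R? x y | sumOver-count-∷ x xs ys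
  ... | yes _ | ih = cong suc (trans (x∙yz≈y∙xz (count (R? x) ys) (count (λ x → R? x y) xs) _) (cong (count (λ x → R? x y) xs +_) ih))
  ... | no  _ | ih = trans (x∙yz≈y∙xz (count (R? x) ys) (count (λ x → R? x y) xs) _) (cong (count (λ x → R? x y) xs +_) ih)

  -- Double counting. Long edges are bounded row by row and short edges column by column, so the sum
  -- over the short ones has to be reorganised.
  sumOver-count-comm : ∀ xs ys →
    sumOver (λ x → count (R? x) ys) xs ≡ sumOver (λ y → count (λ x → R? x y) xs) ys
  sumOver-count-comm []       ys = sym (sumOver-0 ys)
    where
    sumOver-0 : (ys : List B) → sumOver (λ _ → 0) ys ≡ 0
    sumOver-0 []       = refl
    sumOver-0 (_ ∷ ys) = sumOver-0 ys
  sumOver-count-comm (x ∷ xs) ys =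
    trans (cong (count (R? x) ys +_) (sumOver-count-comm xs ys)) (sumOver-count-∷ x xs ys)

count-⊎ : {P Q S : Pred A ℓ} (P? : Decidable P) (Q? : Decidable Q) (S? : Decidable S) →
  (∀ {x} → P x → Q x ⊎ S x) → ∀ xs → count P? xs ≤ count Q? xs + count S? xs
count-⊎ P? Q? S? split []       = z≤n
count-⊎ P? Q? S? split (x ∷ xs) with P? x | Q? x | S? x | count-⊎ P? Q? S? split xs
... | yes p | yes _ | yes _ | ih = s≤s (≤-trans ih (+-monoʳ-≤ _ (n≤1+n _)))
... | yes p | yes _ | no  _ | ih = s≤s ih
... | yes p | no  _ | yes _ | ih = ≤-trans (s≤s ih) (≤-reflexive (sym (+-suc _ _)))
... | yes p | no ¬q | no ¬s | ih = contradiction (split p) [ ¬q , ¬s ]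
... | no  _ | yes _ | yes _ | ih = m≤n⇒m≤1+n (≤-trans ih (+-monoʳ-≤ _ (n≤1+n _)))
... | no  _ | yes _ | no  _ | ih = m≤n⇒m≤1+n ih
... | no  _ | no  _ | yes _ | ih = ≤-trans ih (+-monoʳ-≤ _ (n≤1+n _))
... | no  _ | no  _ | no  _ | ih = ih

sumOver-≤-+ : {f g h : A → ℕ} → (∀ x → f x ≤ g x + h x) →
  ∀ xs → sumOver f xs ≤ sumOver g xs + sumOver h xs
sumOver-≤-+                         f≤ []       = z≤n
sumOver-≤-+ {f = f} {g = g} {h = h} f≤ (x ∷ xs) =
  ≤-trans (+-mono-≤ (f≤ x) (sumOver-≤-+ f≤ xs))
          (≤-reflexive (+-interchange (g x) (h x) (sumOver g xs) (sumOver h xs)))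

length*-≤-sumOver : ∀ {k} {f : A → ℕ} → (∀ x → k ≤ f x) → ∀ xs → length xs * k ≤ sumOver f xs
length*-≤-sumOver k≤ []       = z≤n
length*-≤-sumOver k≤ (x ∷ xs) = +-mono-≤ (k≤ x) (length*-≤-sumOver k≤ xs)

-- This adds up logarithmic bounds: log₂ K for every `f x` gives `length xs` times log₂ K for the
-- sum, all in exponential form.
2^sumOver-≤ : ∀ {K} {f : A → ℕ} → (∀ x → 2 ^ f x ≤ K) → ∀ xs → 2 ^ sumOver f xs ≤ K ^ length xs
2^sumOver-≤         f≤ []       = ≤-refl
2^sumOver-≤ {f = f} f≤ (x ∷ xs) =
  ≤-trans (≤-reflexive (^-distribˡ-+-* 2 (f x) (sumOver f xs)))
          (*-mono-≤ (f≤ x) (2^sumOver-≤ f≤ xs))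

-- Sending i to the index of `f i` in the filtered list is an injection of `Fin k` into `Fin` of its
-- length.
injective⇒≤-count : ∀ {k q} {P : Pred (Fin q) ℓ} (P? : Decidable P) {f : Fin k → Fin q} →
  Injective _≡_ _≡_ f → (∀ i → P (f i)) → k ≤ count P? (allFin q)
injective⇒≤-count P? {f} f-inj Pf =
  injective⇒≤ (λ {i} {j} eq → f-inj (index-injective (setoid _) (f∈ i) (f∈ j) eq))
  where
  f∈ : ∀ i → f i ∈ filter P? (allFin _)
  f∈ i = ∈-filter⁺ P? (∈-allFin (f i)) (Pf i)

filter-allFin-sorted : ∀ {q} {P : Pred (Fin q) ℓ} (P? : Decidable P) →
  AllPairs Fin._<_ (filter P? (allFin q))
filter-allFin-sorted P? = filter⁺ P? (tabulate⁺-< id)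

length-allFin : ∀ n → length (allFin n) ≡ n
length-allFin n = length-tabulate {n = n} id

numEdges≡sumOver : ∀ {p q} (G : OrderedBipartiteGraph p q) →
  numEdges G ≡ sumOver (λ u → count (edge? G u) (allFin q)) (allFin p)
numEdges≡sumOver {p} {q} G = count-cartesianProduct (edge? G) (allFin p) (allFin q)

-- The upper bound

module _ {p q : ℕ} (G : OrderedBipartiteGraph p q) where

  ≡⇒samePart : ∀ {x y} → x ≡ y → SamePart G x y
  ≡⇒samePart {inj₁ _} refl = inj₁ tt
  ≡⇒samePart {inj₂ _} refl = inj₂ tt

  <ᵛ-irrefl : ∀ {x y} → x ≡ y → ¬ _<ᵛ_ G x y
  <ᵛ-irrefl refl (inj₁ x<x) = <-irrefl refl x<x
  <ᵛ-irrefl refl (inj₂ x<x) = <-irrefl refl x<x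

  -- Equal vertices lie in the same part, where a difference of index would make one strictly
  -- smaller than the other.
  increasing⇒distinct : ∀ {k} (w : Vector (Vertex G) k) →
    (∀ {i j} → i Fin.< j → SamePart G (w i) (w j) → _<ᵛ_ G (w i) (w j)) → Injective _≡_ _≡_ w
  increasing⇒distinct w inc {i} {j} wᵢ≡wⱼ with <-cmp i j
  ... | tri≈ _ i≡j _ = i≡j
  ... | tri< i<j _ _ = contradiction (inc i<j (≡⇒samePart wᵢ≡wⱼ)) (<ᵛ-irrefl wᵢ≡wⱼ)
  ... | tri> _ _ j<i = contradiction (inc j<i (≡⇒samePart (sym wᵢ≡wⱼ))) (<ᵛ-irrefl (sym wᵢ≡wⱼ))

  -- 2 b ≤ m + a expresses 2 (b − a) ≤ m − a.
  ShortStep : Fin p → Fin q → Fin q → Fin q → Set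
  ShortStep u a b m =
    Edge G u b × Edge G u m × a Fin.< b × b Fin.≤ m × 2 * toℕ b ≤ toℕ m + toℕ a

  Short Long : Fin p → Fin q → Set
  Short u a = Edge G u a × ∃[ b ] ∃[ m ] ShortStep u a b m
  Long  u a = Edge G u a × ¬ (∃[ b ] ∃[ m ] ShortStep u a b m)

  step? : ∀ u a → Dec (∃[ b ] ∃[ m ] ShortStep u a b m)
  step? u a = any? λ b → any? λ m →
    edge? G u b ×-dec edge? G u m ×-dec a <ᶠ? b ×-dec b ≤ᶠ? m ×-dec 2 * toℕ b ≤? toℕ m + toℕ a

  short? : Decidable₂ Short
  short? u a = edge? G u a ×-dec step? u a

  long? : Decidable₂ Long
  long? u a = edge? G u a ×-dec ¬? (step? u a)

  edge⇒long⊎short : ∀ {u a} → Edge G u a → Long u a ⊎ Short u a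
  edge⇒long⊎short {u} {a} ua with step? u a
  ... | yes s = inj₂ (ua , s)
  ... | no ¬s = inj₁ (ua , ¬s)

  -- The witness `m` is the last entry of the list. With the next entry `y` as intermediate
  -- neighbour, `x` would be short unless m + x < 2 y, that is, 2 (m - y) < m - x. So m + 1 - x at
  -- least doubles with each step towards the front; the shift by one makes it start at 1 = 2^0,
  -- where x = m.
  long-chain : ∀ {u x xs} → AllPairs Fin._<_ (x ∷ xs) → All (Long u) (x ∷ xs) →
    ∃[ m ] Edge G u m × x Fin.≤ m × 2 ^ length xs + toℕ x ≤ suc (toℕ m)
  long-chain {x = x} {[]}     _ ((ux , _) ∷ _) = x , ux , ≤-refl , ≤-refl
  long-chain {x = x} {y ∷ xs} ((x<y ∷ _) ∷ sorted) ((_ , ¬short) ∷ longs)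
    with m , um , y≤m , 2^l+y≤1+m ← long-chain sorted longs
    = m , um , ≤-trans (<⇒≤ x<y) y≤m , bound {2 ^ length xs} {toℕ x} {toℕ y} 2^l+y≤1+m
        (≰⇒> λ 2y≤m+x → ¬short (y , m , uy , um , x<y , y≤m , 2y≤m+x))
    where
    uy : Edge G _ y
    uy with (e , _) ← All.head longs = e
    bound : ∀ {P x y m} → P + y ≤ suc m → m + x < 2 * y → 2 * P + x ≤ suc m
    bound {P} {x} {y} {m} P+y≤1+m m+x<2y = +-cancelʳ-≤ (2 * y + m + 1) _ _ (begin
      2 * P + x + (2 * y + m + 1)    ≡⟨ lhs P x y m ⟩
      2 * (P + y) + suc (m + x)      ≤⟨ +-mono-≤ (*-monoʳ-≤ 2 P+y≤1+m) m+x<2y ⟩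
      2 * suc m + 2 * y              ≡⟨ rhs m y ⟩
      suc m + (2 * y + m + 1)        ∎)
      where
      open ≤-Reasoning
      lhs : ∀ P x y m → 2 * P + x + (2 * y + m + 1) ≡ 2 * (P + y) + suc (m + x)
      lhs = solve-∀
      rhs : ∀ m y → 2 * suc m + 2 * y ≡ suc m + (2 * y + m + 1)
      rhs = solve-∀

  module _ (restricted : IsPathRestricted G) where

    -- If b ≤ m, then u, a, u′, m is a forward path whose largest V-vertex is m, and a < b ≤ m makes
    -- (u , b) a back edge to it. The upper bound uses path restriction through this case.
    restricted₄ : ∀ {u u′ a b m} → Edge G u a → Edge G u′ a → Edge G u b → Edge G u′ m →
      u Fin.< u′ → a Fin.< b → a Fin.< m → m Fin.< b
    restricted₄ {u} {u′} {a} {b} {m} ua u′a ub u′m u<u′ a<b a<m with b ≤ᶠ? m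
    ... | no  b≰m = ≰⇒> b≰m
    ... | yes b≤m = contradiction back (restricted w path (inj₂ b))
      where
      w : Vector (Vertex G) 4
      w zero                   = inj₁ u
      w (suc zero)             = inj₂ a
      w (suc (suc zero))       = inj₁ u′
      w (suc (suc (suc zero))) = inj₂ m

      inc : ∀ {i j} → i Fin.< j → SamePart G (w i) (w j) → _<ᵛ_ G (w i) (w j)
      inc {zero}             {suc (suc zero)}       _ _ = inj₁ u<u′
      inc {suc zero}         {suc (suc (suc zero))} _ _ = inj₂ a<m
      inc {zero}             {suc zero}             _ ()
      inc {zero}             {suc (suc (suc zero))} _ ()
      inc {suc zero}         {suc (suc zero)}       _ ()
      inc {suc (suc zero)}   {suc (suc (suc zero))} _ ()
      inc {zero}             {zero}                 ()
      inc {suc zero}         {suc zero}             (s≤s ())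
      inc {suc (suc zero)}   {suc zero}             (s≤s ())
      inc {suc (suc zero)}   {suc (suc zero)}       (s≤s (s≤s ()))
      inc {suc (suc (suc zero))} {suc zero}         (s≤s ())
      inc {suc (suc (suc zero))} {suc (suc zero)}   (s≤s (s≤s ()))
      inc {suc (suc (suc zero))} {suc (suc (suc zero))} (s≤s (s≤s (s≤s ())))

      path : IsForwardPath G w
      path = record
        { distinct   = increasing⇒distinct w inc
        ; adjacent   = λ where
            zero             → ua
            (suc zero)       → u′a
            (suc (suc zero)) → u′m
        ; increasing = inc
        }

      back : IsBackEdge G w (inj₂ b)
      back = record
        { edge  = ub
        ; w₁<x  = inj₂ a<b
        ; x≤max = inj₂ m , record
            { onPath   = suc (suc (suc zero)) , refl
            ; samePart = inj₂ tt
            ; largest  = λ where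
                (suc zero)             _ → inj₂ (<⇒≤ a<m)
                (suc (suc (suc zero))) _ → inj₂ ≤-refl
            } , inj₂ b≤m
        }

    -- For consecutive rows x < y, `restricted₄` puts the far neighbour m′ of y below the near
    -- neighbour b of x, so m - a ≥ 2 (b - a) > 2 (m′ - a). At the last row a < b ≤ m gives m - a ≥
    -- 1 = 2^0. The step of the front row is part of the conclusion because the induction needs the
    -- edge from y to m′.
    short-chain : ∀ {a x xs} → AllPairs Fin._<_ (x ∷ xs) → All (λ u → Short u a) (x ∷ xs) →
      ∃[ b ] ∃[ m ] ShortStep x a b m × 2 ^ length xs + toℕ a ≤ toℕ m
    short-chain {xs = []}     _ ((_ , b , m , s@(_ , _ , a<b , b≤m , _)) ∷ _) =
      b , m , s , <-≤-trans a<b b≤m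
    short-chain {a} {x} {y ∷ xs} ((x<y ∷ _) ∷ sorted) ((xa , b , m , s@(xb , _ , a<b , _ , 2b≤m+a)) ∷ shorts)
      with b′ , m′ , (_ , ym′ , a<b′ , b′≤m′ , _) , 2^l+a≤m′ ← short-chain sorted shorts
      = b , m , s , bound {2 ^ length xs} 2^l+a≤m′
          (restricted₄ xa ya xb ym′ x<y a<b (<-≤-trans a<b′ b′≤m′)) 2b≤m+a
      where
      ya : Edge G y a
      ya with (e , _) ← All.head shorts = e
      bound : ∀ {P a b m m′} → P + a ≤ m′ → m′ < b → 2 * b ≤ m + a → 2 * P + a ≤ m
      bound {P} {a} {b} {m} {m′} P+a≤m′ m′<b 2b≤m+a = +-cancelʳ-≤ a _ _ (begin
        2 * P + a + a    ≡⟨ lhs P a ⟩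
        2 * (P + a)      ≤⟨ *-monoʳ-≤ 2 (≤-trans P+a≤m′ (<⇒≤ m′<b)) ⟩
        2 * b            ≤⟨ 2b≤m+a ⟩
        m + a            ∎)
        where
        open ≤-Reasoning
        lhs : ∀ P a → 2 * P + a + a ≡ 2 * (P + a)
        lhs = solve-∀

    -- Summation of long edges over rows and of short edges over columns

    module _ (2≤n : 2 ≤ p + q) where

      q≤n : q ≤ p + q
      q≤n = m≤n+m q p

      1≤2n : 1 ≤ 2 * (p + q)
      1≤2n = ≤-trans (<⇒≤ 2≤n) (m≤m+n _ _)

      -- This says that the count is at most 1 + log₂ n. For l + 1 long edges the chain bound gives
      -- 2^l ≤ m + 1 ≤ q ≤ n, and the front edge accounts for the factor 2.
      long-count : ∀ u → 2 ^ count (long? u) (allFin q) ≤ 2 * (p + q)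
      long-count u with filter (long? u) (allFin q)
                      | filter-allFin-sorted (long? u) | all-filter (long? u) (allFin q)
      ... | []     | _      | _     = 1≤2n
      ... | x ∷ xs | sorted | longs with m , _ , _ , le ← long-chain sorted longs =
        *-monoʳ-≤ 2 (≤-trans (m+n≤o⇒m≤o (2 ^ length xs) le) (≤-trans (toℕ<n m) q≤n))

      short-count : ∀ a → 2 ^ count (λ u → short? u a) (allFin p) ≤ 2 * (p + q)
      short-count a with filter (λ u → short? u a) (allFin p)
                       | filter-allFin-sorted (λ u → short? u a)
                       | all-filter (λ u → short? u a) (allFin p)
      ... | []     | _      | _      = 1≤2n
      ... | x ∷ xs | sorted | shorts with _ , m , _ , le ← short-chain sorted shorts =
        *-monoʳ-≤ 2 (≤-trans (m+n≤o⇒m≤o (2 ^ length xs) le) (≤-trans (<⇒≤ (toℕ<n m)) q≤n))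

      -- The p rows and q columns together receive at most n (1 + log₂ n) edges, which is where the
      -- constant 1 comes from.
      upperBound : numEdges G ≤nlog₂n+Cn[n= p + q ,C= 1 ]
      upperBound = begin
        2 ^ numEdges G           ≤⟨ ^-monoʳ-≤ 2 numEdges≤ ⟩
        2 ^ (L + S)              ≡⟨ ^-distribˡ-+-* 2 L S ⟩
        2 ^ L * 2 ^ S            ≤⟨ *-mono-≤ (2^sumOver-≤ long-count (allFin p)) (2^sumOver-≤ short-count (allFin q)) ⟩
        K ^ length (allFin p) * K ^ length (allFin q)
                                 ≡⟨ cong₂ (λ i j → K ^ i * K ^ j) (length-allFin p) (length-allFin q) ⟩
        K ^ p * K ^ q            ≡⟨ ^-distribˡ-+-* K p q ⟨
        K ^ n                    ≡⟨ ^-distribʳ-* 2 n n ⟩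
        2 ^ n * n ^ n            ≡⟨ *-comm (2 ^ n) (n ^ n) ⟩
        n ^ n * 2 ^ n            ≡⟨ cong (λ i → n ^ n * 2 ^ i) (*-identityˡ n) ⟨
        n ^ n * 2 ^ (1 * n)      ∎
        where
        open ≤-Reasoning
        n K L S : ℕ
        n = p + q
        K = 2 * n
        L = sumOver (λ u → count (long? u) (allFin q)) (allFin p)
        S = sumOver (λ a → count (λ u → short? u a) (allFin p)) (allFin q)

        ^-distribʳ-* : ∀ a b k → (a * b) ^ k ≡ a ^ k * b ^ k
        ^-distribʳ-* a b zero    = refl
        ^-distribʳ-* a b (suc k) = trans (cong (a * b *_) (^-distribʳ-* a b k)) (*-interchange a b (a ^ k) (b ^ k))

        numEdges≤ : numEdges G ≤ L + S
        numEdges≤ = begin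
          numEdges G ≡⟨ numEdges≡sumOver G ⟩
          sumOver (λ u → count (edge? G u) (allFin q)) (allFin p)
            ≤⟨ sumOver-≤-+ (λ u → count-⊎ (edge? G u) (long? u) (short? u) edge⇒long⊎short (allFin q)) (allFin p) ⟩
          L + sumOver (λ u → count (short? u) (allFin q)) (allFin p)
            ≡⟨ cong (L +_) (sumOver-count-comm short? (allFin p) (allFin q)) ⟩
          L + S ∎

-- The lower bound

n<2^n : ∀ n → n < 2 ^ n
n<2^n zero    = s≤s z≤n
n<2^n (suc n) = begin-strict
  suc n              ≤⟨ n<2^n n ⟩
  2 ^ n              <⟨ m<m+n (2 ^ n) (m^n>0 2 n) ⟩
  2 ^ n + 2 ^ n      ≡⟨ cong (2 ^ n +_) (+-identityʳ (2 ^ n)) ⟨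
  2 ^ suc n          ∎
  where open ≤-Reasoning

2^-cancel-< : ∀ {a b} → 2 ^ a < 2 ^ b → a < b
2^-cancel-< {a} {b} 2^a<2^b with b ≤? a
... | no  b≰a = ≰⇒> b≰a
... | yes b≤a = contradiction (^-monoʳ-≤ 2 b≤a) (<⇒≱ 2^a<2^b)

2^-injective : ∀ {a b} → 2 ^ a ≡ 2 ^ b → a ≡ b
2^-injective {a} {b} eq with Nat.<-cmp a b
... | tri< a<b _ _ = contradiction eq (<⇒≢ (^-monoʳ-< 2 ≤-refl a<b))
... | tri≈ _ a≡b _ = a≡b
... | tri> _ _ b<a = contradiction (sym eq) (<⇒≢ (^-monoʳ-< 2 ≤-refl b<a))

-- The witness k is the integer part of log₂ n.
2^-bracket : ∀ n → 1 ≤ n → ∃[ k ] 2 ^ k ≤ n × n < 2 ^ suc k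
2^-bracket 1             _ = 0 , ≤-refl , ≤-refl
2^-bracket (suc (suc n)) _ with k , 2^k≤ , <2^1+k ← 2^-bracket (suc n) (s≤s z≤n) | suc (suc n) <? 2 ^ suc k
... | yes <2^1+k′ = k , m≤n⇒m≤1+n 2^k≤ , <2^1+k′
... | no  ≮2^1+k  = suc k , ≮⇒≥ ≮2^1+k , ≤-<-trans <2^1+k (^-monoʳ-< 2 ≤-refl (n<1+n (suc k)))

+-balance-< : ∀ {m n a b} → m + a ≡ n + b → m < n → b < a
+-balance-< {m} {n} {a} {b} eq m<n with a ≤? b
... | no  a≰b = ≰⇒> a≰b
... | yes a≤b = contradiction eq (<⇒≢ (+-mono-<-≤ m<n a≤b))

-- Raising u₀ to u₁ or v₀ to v leaves a smaller gap below N, so b and c are less than a. As the gaps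
-- are powers of two, the two smaller ones together still fit into the largest: 2^b + 2^c ≤ 2^a.
-- Adding the last two equations and cancelling the first gives the claim.
powers-sum : ∀ u₀ u₁ v₀ v a b c {N} → u₀ + v₀ + 2 ^ a ≡ N → u₁ + v₀ + 2 ^ b ≡ N → u₀ + v + 2 ^ c ≡ N →
  u₀ < u₁ → v₀ < v → N ≤ u₁ + v
powers-sum u₀ u₁ v₀ v a b c {N} e₁ e₂ e₃ u₀<u₁ v₀<v =
  +-cancelʳ-≤ (u₀ + v₀ + 2 ^ a) _ _ (begin
    N + (u₀ + v₀ + 2 ^ a)                      ≡⟨ cong (N +_) e₁ ⟩
    N + N                                      ≡⟨ cong₂ _+_ e₂ e₃ ⟨
    (u₁ + v₀ + 2 ^ b) + (u₀ + v + 2 ^ c)       ≡⟨ regroup u₀ u₁ v₀ v (2 ^ b) (2 ^ c) ⟩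
    (u₁ + v) + (u₀ + v₀ + (2 ^ b + 2 ^ c))     ≤⟨ +-monoʳ-≤ (u₁ + v) (+-monoʳ-≤ (u₀ + v₀) 2^b+2^c≤2^a) ⟩
    (u₁ + v) + (u₀ + v₀ + 2 ^ a)               ∎)
  where
  open ≤-Reasoning
  regroup : ∀ u₀ u₁ v₀ v B C → (u₁ + v₀ + B) + (u₀ + v + C) ≡ (u₁ + v) + (u₀ + v₀ + (B + C))
  regroup = solve-∀

  b<a : b < a
  b<a = 2^-cancel-< (+-balance-< (trans e₁ (sym e₂)) (+-monoˡ-< v₀ u₀<u₁))

  c<a : c < a
  c<a = 2^-cancel-< (+-balance-< (trans e₁ (sym e₃)) (+-monoʳ-< u₀ v₀<v))

  b⊔c<a : suc (b ⊔ c) ≤ a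
  b⊔c<a = ⊔-lub b<a c<a

  2^b+2^c≤2^a : 2 ^ b + 2 ^ c ≤ 2 ^ a
  2^b+2^c≤2^a = begin
    2 ^ b + 2 ^ c                ≤⟨ +-mono-≤ (^-monoʳ-≤ 2 (m≤m⊔n b c)) (^-monoʳ-≤ 2 (m≤n⊔m b c)) ⟩
    2 ^ (b ⊔ c) + 2 ^ (b ⊔ c)    ≡⟨ cong (2 ^ (b ⊔ c) +_) (+-identityʳ _) ⟨
    2 ^ suc (b ⊔ c)              ≤⟨ ^-monoʳ-≤ 2 b⊔c<a ⟩
    2 ^ a                        ∎

-- Taking the exponent in Fin q loses nothing, as t < 2 ^ t ≤ q, and makes edges decidable.
powerGraph : ∀ p q → OrderedBipartiteGraph p q
powerGraph p q = record
  { Edge  = λ u v → ∃[ t ] toℕ u + toℕ v + 2 ^ toℕ {q} t ≡ q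
  ; edge? = λ u v → any? λ t → toℕ u + toℕ v + 2 ^ toℕ t ≟ q
  }

-- Path restriction and row degrees of the power graph

module _ {p q : ℕ} where

  private
    G : OrderedBipartiteGraph p q
    G = powerGraph p q

  -- The edge condition is symmetric in u and v. Forgetting the part lets paths that start in U and
  -- in V be treated by one argument.
  position : Vertex G → ℕ
  position (inj₁ u) = toℕ u
  position (inj₂ v) = toℕ v

  adj⇒sum : ∀ x y → Adj G x y → ∃[ t ] position x + position y + 2 ^ t ≡ q
  adj⇒sum (inj₁ _) (inj₂ _) (t , eq) = toℕ t , eq
  adj⇒sum (inj₂ v) (inj₁ u) (t , eq) = toℕ t , trans (cong (_+ 2 ^ toℕ t) (+-comm (toℕ v) (toℕ u))) eq

  adj-adj⇒samePart : ∀ x y z → Adj G x y → Adj G y z → SamePart G x z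
  adj-adj⇒samePart (inj₁ _) (inj₂ _) (inj₁ _) _ _ = inj₁ tt
  adj-adj⇒samePart (inj₂ _) (inj₁ _) (inj₂ _) _ _ = inj₂ tt

  adj⇒¬samePart : ∀ {x y} → Adj G x y → ¬ SamePart G x y
  adj⇒¬samePart () (inj₁ _)
  adj⇒¬samePart () (inj₂ _)

  adj-samePart⇒samePart : ∀ x y x′ y′ → Adj G x y → Adj G x′ y′ → SamePart G y y′ → SamePart G x x′
  adj-samePart⇒samePart (inj₁ _) (inj₂ _) (inj₁ _) (inj₂ _) _ _ _ = inj₁ tt
  adj-samePart⇒samePart (inj₂ _) (inj₁ _) (inj₂ _) (inj₁ _) _ _ _ = inj₂ tt
  adj-samePart⇒samePart (inj₁ _) (inj₂ _) (inj₂ _) (inj₁ _) _ _ ()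
  adj-samePart⇒samePart (inj₂ _) (inj₁ _) (inj₁ _) (inj₂ _) _ _ ()

  samePart-sym : ∀ {x y} → SamePart G x y → SamePart G y x
  samePart-sym (inj₁ _) = inj₁ tt
  samePart-sym (inj₂ _) = inj₂ tt

  samePart-trans : ∀ {x y z} → SamePart G x y → SamePart G y z → SamePart G x z
  samePart-trans (inj₁ _) (inj₁ _) = inj₁ tt
  samePart-trans (inj₂ _) (inj₂ _) = inj₂ tt

  position-< : ∀ {x y} → _<ᵛ_ G x y → position x < position y
  position-< (inj₁ lt) = lt
  position-< (inj₂ lt) = lt

  position-≤ : ∀ {x y} → _≤ᵛ_ G x y → position x ≤ position y
  position-≤ (inj₁ le) = le
  position-≤ (inj₂ le) = le

  open IsForwardPath

  w₀~w₂ : ∀ {l} (w : Vector (Vertex G) (3 + l)) → IsForwardPath G w →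
    SamePart G (w zero) (w (suc (suc zero)))
  w₀~w₂ w path = adj-adj⇒samePart _ (w (suc zero)) _ (adjacent path zero) (adjacent path (suc zero))

  -- The vertex M is generalised to any `w i` in the part of `x`. Indices 0 and 2 lie in the other
  -- part, and index 1 contradicts w₁ < x. From index 3 on, the predecessor w′ of wᵢ is at least w₂,
  -- so w₂ + x ≤ w′ + wᵢ < q, while `powers-sum` for the edges w₀w₁, w₁w₂ and w₀x gives q ≤ w₂ + x.
  no-back-edge : ∀ {l} (w : Vector (Vertex G) (suc (suc l))) → IsForwardPath G w →
    ∀ x → Adj G (w zero) x → _<ᵛ_ G (w (suc zero)) x →
    ∀ i → SamePart G x (w i) → ¬ _≤ᵛ_ G x (w i)
  no-back-edge w path x w₀x w₁<x zero             x~wᵢ _    =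
    adj⇒¬samePart w₀x (samePart-sym x~wᵢ)
  no-back-edge w path x w₀x w₁<x (suc zero)       _    x≤wᵢ =
    <⇒≱ (position-< w₁<x) (position-≤ x≤wᵢ)
  no-back-edge w path x w₀x w₁<x (suc (suc zero)) x~wᵢ _    =
    adj⇒¬samePart w₀x (samePart-trans (w₀~w₂ w path) (samePart-sym x~wᵢ))
  no-back-edge w path x w₀x w₁<x (suc (suc (suc j))) x~wᵢ x≤wᵢ
    with a , e₁ ← adj⇒sum (w zero) (w (suc zero)) (adjacent path zero)
       | b , e₂ ← adj⇒sum (w (suc zero)) (w (suc (suc zero))) (adjacent path (suc zero))
       | c , e₃ ← adj⇒sum (w zero) x w₀x
       | d , e₄ ← adj⇒sum (w (inject₁ (suc (suc j)))) (w (suc (suc (suc j)))) (adjacent path (suc (suc j)))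
    = <⇒≱ (begin-strict
        position w₂ + position x          ≤⟨ +-mono-≤ w₂≤w′ (position-≤ x≤wᵢ) ⟩
        position w′ + position wᵢ         <⟨ m<m+n _ (m^n>0 2 d) ⟩
        position w′ + position wᵢ + 2 ^ d ≡⟨ e₄ ⟩
        q                                 ∎)
      (powers-sum (position (w zero)) (position w₂) (position w₁) (position x) a b c
        e₁ (trans (cong (_+ 2 ^ b) (+-comm (position w₂) (position w₁))) e₂) e₃
        (position-< (increasing path (s≤s z≤n) (w₀~w₂ w path))) (position-< w₁<x))
    where
    open ≤-Reasoning
    w₁ w₂ w′ wᵢ : Vertex G
    w₁ = w (suc zero)
    w₂ = w (suc (suc zero))
    w′ = w (inject₁ (suc (suc j)))
    wᵢ = w (suc (suc (suc j)))

    w₂~w′ : SamePart G w₂ w′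
    w₂~w′ = samePart-trans (samePart-sym (w₀~w₂ w path))
      (adj-samePart⇒samePart (w zero) x w′ wᵢ w₀x (adjacent path (suc (suc j))) x~wᵢ)

    w₂≤w′ : position w₂ ≤ position w′
    w₂≤w′ with inject₁ j | w₂~w′
    -- Here `wᵢ` is the vertex of index 3, whose predecessor is `w₂` itself.
    ... | zero  | _     = ≤-refl
    ... | suc _ | w₂~w′ = <⇒≤ (position-< (increasing path (s≤s (s≤s (s≤s z≤n))) w₂~w′))

  powerGraph-restricted : IsPathRestricted G
  powerGraph-restricted w path x back
    with _ , record { onPath = i , refl ; samePart = x~M } , x≤M ← IsBackEdge.x≤max back =
    no-back-edge w path x (IsBackEdge.edge back) (IsBackEdge.w₁<x back) i x~M x≤M

  -- Each exponent t < k yields the neighbour q - u - 2^t, and different exponents yield different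
  -- neighbours.
  powerGraph-row : ∀ {k} (u : Fin p) → (∀ {t} → t < k → toℕ u + 2 ^ t ≤ q) →
    k ≤ count (edge? G u) (allFin q)
  powerGraph-row {k} u u+2^t≤q = injective⇒≤-count (edge? G u) {neighbour} neighbour-injective edge
    where
    sum≤ : (t : Fin k) → toℕ u + 2 ^ toℕ t ≤ q
    sum≤ t = u+2^t≤q (toℕ<n t)

    gap : Fin k → ℕ
    gap t = q ∸ (toℕ u + 2 ^ toℕ t)

    gap+ : ∀ t → gap t + (toℕ u + 2 ^ toℕ t) ≡ q
    gap+ t = m∸n+n≡m (sum≤ t)

    gap<q : ∀ t → gap t < q
    gap<q t = subst (gap t <_) (gap+ t) (m<m+n (gap t) (≤-trans (m^n>0 2 (toℕ t)) (m≤n+m _ (toℕ u))))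

    t<q : ∀ t → toℕ t < q
    t<q t = <-≤-trans (n<2^n (toℕ t)) (≤-trans (m≤n+m _ (toℕ u)) (sum≤ t))

    neighbour : Fin k → Fin q
    neighbour t = fromℕ< (gap<q t)

    edge : ∀ t → Edge G u (neighbour t)
    edge t = fromℕ< (t<q t) , (begin
      toℕ u + toℕ (neighbour t) + 2 ^ toℕ (fromℕ< (t<q t))
        ≡⟨ cong₂ (λ v s → toℕ u + v + 2 ^ s) (toℕ-fromℕ< (gap<q t)) (toℕ-fromℕ< (t<q t)) ⟩
      toℕ u + gap t + 2 ^ toℕ t      ≡⟨ cong (_+ 2 ^ toℕ t) (+-comm (toℕ u) (gap t)) ⟩
      gap t + toℕ u + 2 ^ toℕ t      ≡⟨ +-assoc (gap t) (toℕ u) _ ⟩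
      gap t + (toℕ u + 2 ^ toℕ t)    ≡⟨ gap+ t ⟩
      q                              ∎)
      where open ≡-Reasoning

    neighbour-injective : Injective _≡_ _≡_ neighbour
    neighbour-injective {s} {t} eq =
      toℕ-injective (2^-injective (+-cancelˡ-≡ (toℕ u) _ _ (+-cancelˡ-≡ (gap s) _ _ (begin
        gap s + (toℕ u + 2 ^ toℕ s) ≡⟨ gap+ s ⟩
        q                           ≡⟨ gap+ t ⟨
        gap t + (toℕ u + 2 ^ toℕ t) ≡⟨ cong (_+ (toℕ u + 2 ^ toℕ t)) gap≡ ⟨
        gap s + (toℕ u + 2 ^ toℕ t) ∎))))
      where
      open ≡-Reasoning
      gap≡ : gap s ≡ gap t
      gap≡ = trans (sym (toℕ-fromℕ< (gap<q s))) (trans (cong toℕ eq) (toℕ-fromℕ< (gap<q t)))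

-- Part sizes and edge count for the lower bound

⌈_/4⌉ : ℕ → ℕ
⌈ n /4⌉ = (n + 3) / 4

⌈n/4⌉*4≤n+3 : ∀ n → ⌈ n /4⌉ * 4 ≤ n + 3
⌈n/4⌉*4≤n+3 n = m/n*n≤m (n + 3) 4

n≤⌈n/4⌉*4 : ∀ n → n ≤ ⌈ n /4⌉ * 4
n≤⌈n/4⌉*4 n = +-cancelˡ-≤ 3 _ _ (begin
  3 + n                            ≡⟨ +-comm 3 n ⟩
  n + 3                            ≡⟨ m≡m%n+[m/n]*n (n + 3) 4 ⟩
  (n + 3) % 4 + ⌈ n /4⌉ * 4        ≤⟨ +-monoˡ-≤ _ (s≤s⁻¹ (m%n<n (n + 3) 4)) ⟩
  3 + ⌈ n /4⌉ * 4                  ∎)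
  where open ≤-Reasoning

⌈n/4⌉≤n : ∀ n → ⌈ n /4⌉ ≤ n
⌈n/4⌉≤n zero      = z≤n
⌈n/4⌉≤n n@(suc m) = *-cancelʳ-≤ _ _ 4 (begin
  ⌈ n /4⌉ * 4      ≤⟨ ⌈n/4⌉*4≤n+3 n ⟩
  n + 3            ≤⟨ +-monoʳ-≤ n (m≤m*n 3 n) ⟩
  n + 3 * n        ≡⟨ *-comm 4 n ⟩
  n * 4            ∎)
  where open ≤-Reasoning

-- With U a quarter of the vertices, every row has at least k edges, where 2^k ≤ n < 2^(k+1). Then n
-- log₂ n ≤ (k + 1) n ≤ 2 k · 4 p = 8 p k, using k ≥ 1 and n ≤ 4 p; hence the constant 1/8.
lowerBound : ∀ n → 2 ≤ n →
  ∃[ p ] ∃[ q ] Σ[ G ∈ OrderedBipartiteGraph p q ]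
    numVertices G ≡ n × IsPathRestricted G × numEdges G ≥cnlog₂n[c= 1ℤ /ℚ 8 ,n= n ]
lowerBound n 2≤n with 2^-bracket n (<⇒≤ 2≤n)
... | k , 2^k≤n , n<2^1+k =
  p , q , G , m+[n∸m]≡n (⌈n/4⌉≤n n) , powerGraph-restricted , bound
  where
  p q : ℕ
  p = ⌈ n /4⌉
  q = n ∸ p

  G : OrderedBipartiteGraph p q
  G = powerGraph p q

  row-fits : ∀ (u : Fin p) {t} → t < k → toℕ u + 2 ^ t ≤ q
  -- Up to rounding, u and p are at most n/4 each and 2^t is at most n/2. After doubling, the
  -- rounded-up quarter costs an excess of 3, and 2 n + 3 < 2 (n + 2) still yields u + 2^t + p ≤ n.
  row-fits u {t} t<k = m+n≤o⇒m≤o∸n _ (s≤s⁻¹ (s<s⁻¹ (*-cancelˡ-< 2 _ _ (begin-strict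
    2 * suc (toℕ u + 2 ^ t + p)        ≡⟨ regroup (toℕ u) (2 ^ t) p ⟩
    2 * suc (toℕ u) + 2 * p + 2 ^ suc t ≤⟨ +-mono-≤ (+-monoˡ-≤ (2 * p) (*-monoʳ-≤ 2 (toℕ<n u))) (≤-trans (^-monoʳ-≤ 2 t<k) 2^k≤n) ⟩
    2 * p + 2 * p + n                  ≡⟨ quadruple p n ⟩
    p * 4 + n                          ≤⟨ +-monoˡ-≤ n (⌈n/4⌉*4≤n+3 n) ⟩
    n + 3 + n                          <⟨ ≤-reflexive (double n) ⟩
    2 * suc (suc n)                    ∎))))
    where
    open ≤-Reasoning
    regroup : ∀ u P p → 2 * suc (u + P + p) ≡ 2 * suc u + 2 * p + 2 * P
    regroup = solve-∀
    quadruple : ∀ p n → 2 * p + 2 * p + n ≡ p * 4 + n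
    quadruple = solve-∀
    double : ∀ n → suc (n + 3 + n) ≡ 2 * suc (suc n)
    double = solve-∀

  p*k≤numEdges : p * k ≤ numEdges G
  p*k≤numEdges = begin
    p * k                     ≡⟨ cong (_* k) (length-allFin p) ⟨
    length (allFin p) * k     ≤⟨ length*-≤-sumOver (λ u → powerGraph-row u (row-fits u)) (allFin p) ⟩
    sumOver (λ u → count (edge? G u) (allFin q)) (allFin p) ≡⟨ numEdges≡sumOver G ⟨
    numEdges G                ∎
    where open ≤-Reasoning

  1≤k : 1 ≤ k
  1≤k = s<s⁻¹ (2^-cancel-< (≤-<-trans 2≤n n<2^1+k))

  -- The factors 1 and 8 are the numerator and the denominator of c = 1/8.
  bound : n ^ (1 * n) ≤ 2 ^ (8 * numEdges G)
  bound = begin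
    n ^ (1 * n)              ≤⟨ ^-monoˡ-≤ (1 * n) (<⇒≤ n<2^1+k) ⟩
    (2 ^ suc k) ^ (1 * n)    ≡⟨ ^-*-assoc 2 (suc k) (1 * n) ⟩
    2 ^ (suc k * (1 * n))    ≤⟨ ^-monoʳ-≤ 2 (begin
      suc k * (1 * n)        ≤⟨ *-mono-≤ (+-monoˡ-≤ k 1≤k) (≤-trans (≤-reflexive (*-identityˡ n)) (n≤⌈n/4⌉*4 n)) ⟩
      (k + k) * (p * 4)      ≡⟨ regroup k p ⟩
      8 * (p * k)            ≤⟨ *-monoʳ-≤ 8 p*k≤numEdges ⟩
      8 * numEdges G         ∎) ⟩
    2 ^ (8 * numEdges G)     ∎
    where
    open ≤-Reasoning
    regroup : ∀ k p → (k + k) * (p * 4) ≡ 8 * (p * k)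
    regroup = solve-∀

theorem4p2 : (Σ[ C ∈ ℕ ]
    (∀ (p q : ℕ) (G : OrderedBipartiteGraph p q) →
    2 ≤ numVertices G →
    IsPathRestricted G →
    numEdges G ≤nlog₂n+Cn[n= numVertices G ,C= C ]))
    ×
    (Σ[ c ∈ ℚ ] Positive c ×
    (∀ (n : ℕ) → 2 ≤ n →
    ∃[ p ] ∃[ q ] Σ[ G ∈ OrderedBipartiteGraph p q ]
    numVertices G ≡ n ×
    IsPathRestricted G ×
    numEdges G ≥cnlog₂n[c= c ,n= n ]))
theorem4p2 = (1 , λ p q G 2≤n restricted → upperBound G restricted 2≤n) , (1ℤ /ℚ 8 , _ , lowerBound)
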